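{- In Version A, played on any finite number of piles of tokens, a position is a $\mathcal{P}$-position if and only if every pile has an even number of tokens.
   Context: Version A is the following two-player impartial game. A position consists of finitely many piles of tokens (sizes are nonnegative integers). The players alternate turns; on a turn, the player selects any nonempty set of nonempty piles and removes exactly one token from each selected pile. The last player to move wins (a player with no legal move loses). A position is a $\mathcal{P}$-position if the player who is not about to move (the previous player) has a winning strategy, equivalently if none of its options is a $\mathcal{P}$-position; otherwise it is an $\mathcal{N}$-position. An option of a position is a position reachable from it in one move. -}

module Defs where

open import Level using (Level; _⊔_; 0ℓ)
open import Data.Bool.Base using (if_then_else_)
open import Data.Fin.Subset using (Subset; Nonempty; _∈_)
open import Data.Nat.Base using (ℕ; pred; _>_)
open import Data.Product.Base using (∃-syntax; _×_)
open import Data.Vec.Base using (Vec; lookup; zipWith)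
open import Relation.Binary.Core using (Rel)
open import Relation.Binary.PropositionalEquality.Core using (_≡_)

-- Winning strategies under normal play, for an impartial game given by its
-- option relation (p ⟶ q means that q is an option of p).  An inhabitant of
-- PreviousWins _⟶_ p or NextWins _⟶_ p is a winning strategy tree for that
-- player: it picks one move at each of the player's turns and answers every
-- move of the opponent.  Being inductive, the trees are well-founded, so every
-- play following the strategy ends, and it ends at a position where the
-- opponent is to move and has no move.
module _ {a ℓ : Level} {A : Set a} (_⟶_ : Rel A ℓ) where

  mutual

    data PreviousWins (p : A) : Set (a ⊔ ℓ) where
      reply : (∀ q → p ⟶ q → NextWins q) → PreviousWins p

    data NextWins (p : A) : Set (a ⊔ ℓ) where
      move : ∀ q → p ⟶ q → PreviousWins q → NextWins p

Position : ℕ → Set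
Position n = Vec ℕ n

-- The truncation in pred is never used in a legal move, since the selected
-- piles are then required to be nonempty.
removeOne : ∀ {n} → Subset n → Position n → Position n
removeOne = zipWith (λ selected m → if selected then pred m else m)

VersionA : ∀ n → Rel (Position n) 0ℓ
VersionA n p q =
  ∃[ S ] Nonempty S × (∀ i → i ∈ S → lookup p i > 0) × q ≡ removeOne S p

IsPPosition : ∀ {n} → Position n → Set
IsPPosition {n} = PreviousWins (VersionA n)

{-# OPTIONS --safe #-}
-- The all-even positions are closed under repeating the opponent's move: a
-- selected pile is even and positive, so it holds at least two tokens.  Hence
-- the previous player wins from them by mirroring.  From any other position the
-- next player moves to an all-even one by taking a token from each odd pile.
module Submission where

open import Defs
open import Data.Bool.Base using (true; false; not; if_then_else_)
open import Data.Empty using (⊥)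
open import Data.Fin.Subset using (Subset; _∈_)
open import Data.Nat.Base using (ℕ; zero; suc; pred; _≤_; _<_; _>_; z≤n; s≤s; z<s)
open import Data.Nat.Divisibility using (_∣_; _∤_; _∣?_; _∣0; ∣-refl; ∣1⇒≡1; ∣m∣n⇒∣m+n; ∣m+n∣m⇒∣n)
open import Data.Nat.Induction using (<-wellFounded)
open import Data.Nat.Properties using (≤-refl; <-trans; pred[n]≤n; +-mono-≤; +-mono-≤-<; +-monoʳ-≤)
open import Data.Product.Base using (_,_)
open import Data.Sum.Base using (_⊎_; inj₁; inj₂; swap; map₁)
open import Data.Vec.Base using ([]; _∷_; here; there; lookup; map; sum)
open import Data.Vec.Properties using (lookup-map; lookup-zipWith; lookup⇒[]=; []=⇒lookup)
open import Function.Bundles using (_⇔_; mk⇔)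
open import Induction.WellFounded using (Acc; acc)
open import Relation.Binary.Core using (Rel)
open import Relation.Binary.PropositionalEquality using (_≡_; refl; cong; sym; trans)
open import Relation.Nullary.Decidable using (Dec; yes; no; does; dec-true; dec-false)
open import Relation.Nullary.Negation using (contradiction)

private
  variable
    n : ℕ

AllEven : Position n → Set
AllEven p = ∀ i → 2 ∣ lookup p i

-- Play the two strategies against each other: the move chosen by one is fed to the other, the roles
-- swap at the option reached, and the inductive trees cannot descend forever.
previousWins-nextWins-⊥ : ∀ {a ℓ} {A : Set a} {_⟶_ : Rel A ℓ} {p : A} →
                          PreviousWins _⟶_ p → NextWins _⟶_ p → ⊥
previousWins-nextWins-⊥ (reply f) (move q p⟶q w) = previousWins-nextWins-⊥ w (f q p⟶q)

2∣n⊎2∣1+n : ∀ m → 2 ∣ m ⊎ 2 ∣ suc m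
2∣n⊎2∣1+n zero    = inj₁ (2 ∣0)
2∣n⊎2∣1+n (suc m) = swap (map₁ (∣m∣n⇒∣m+n ∣-refl) (2∣n⊎2∣1+n m))

2∤n⇒2∣pred[n] : ∀ m → 2 ∤ m → 2 ∣ pred m
2∤n⇒2∣pred[n] zero    _   = 2 ∣0
2∤n⇒2∣pred[n] (suc m) odd with 2∣n⊎2∣1+n m
... | inj₁ even = even
... | inj₂ even = contradiction even odd

2∤n⇒n>0 : ∀ m → 2 ∤ m → m > 0
2∤n⇒n>0 zero    odd = contradiction (2 ∣0) odd
2∤n⇒n>0 (suc m) _   = z<s

2∣n⇒2∣pred[pred[n]] : ∀ m → 2 ∣ m → 2 ∣ pred (pred m)
-- Truncation of `pred` gives 0 here and in the next case, so an empty pile that is selected twice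
-- stays even.
2∣n⇒2∣pred[pred[n]] zero          _    = 2 ∣0
2∣n⇒2∣pred[pred[n]] (suc zero)    _    = 2 ∣0
2∣n⇒2∣pred[pred[n]] (suc (suc m)) even = ∣m+n∣m⇒∣n even ∣-refl

2∣n∧n>0⇒pred[n]>0 : ∀ m → 2 ∣ m → m > 0 → pred m > 0
2∣n∧n>0⇒pred[n]>0 (suc zero)    even _ = contradiction (∣1⇒≡1 even) λ ()
2∣n∧n>0⇒pred[n]>0 (suc (suc m)) _    _ = z<s

lookup-removeOne : ∀ (S : Subset n) p i →
                   lookup (removeOne S p) i ≡ (if lookup S i then pred (lookup p i) else lookup p i)
lookup-removeOne S p i = lookup-zipWith _ i S p

if-pred-≤ : ∀ b m → (if b then pred m else m) ≤ m
if-pred-≤ true  m = pred[n]≤n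
if-pred-≤ false m = ≤-refl

sum-removeOne-≤ : ∀ (S : Subset n) p → sum (removeOne S p) ≤ sum p
sum-removeOne-≤ []      []      = z≤n
sum-removeOne-≤ (b ∷ S) (m ∷ p) = +-mono-≤ (if-pred-≤ b m) (sum-removeOne-≤ S p)

-- This makes the token total a termination measure for play. Pile `i` supplies the strict drop;
-- every other pile drops weakly.
sum-removeOne-< : ∀ {S : Subset n} {i} p → i ∈ S → lookup p i > 0 → sum (removeOne S p) < sum p
sum-removeOne-< {S = _ ∷ S} (suc m ∷ p) here        _   = s≤s (+-monoʳ-≤ m (sum-removeOne-≤ S p))
sum-removeOne-< {S = b ∷ _} (m ∷ p)     (there i∈S) p>0 =
  +-mono-≤-< (if-pred-≤ b m) (sum-removeOne-< p i∈S p>0)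

removeOne-twice-even : ∀ (S : Subset n) p → AllEven p → AllEven (removeOne S (removeOne S p))
removeOne-twice-even S p even i
  -- The same Boolean `lookup S i` governs both moves, so a single split leaves either two `pred`s
  -- or none.
  rewrite lookup-removeOne S (removeOne S p) i | lookup-removeOne S p i
  with lookup S i
... | true  = 2∣n⇒2∣pred[pred[n]] (lookup p i) (even i)
... | false = even i

removeOne-repeatable : ∀ (S : Subset n) p → AllEven p → (∀ i → i ∈ S → lookup p i > 0) →
                       ∀ i → i ∈ S → lookup (removeOne S p) i > 0
removeOne-repeatable S p even legal i i∈S
  rewrite lookup-removeOne S p i | []=⇒lookup i∈S =
  2∣n∧n>0⇒pred[n]>0 (lookup p i) (even i) (legal i i∈S)

-- The recursion advances by a full round, the opponent's move and its repetition, so it descends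
-- along accessibility of the token total rather than along the structure of `p`.
allEven⇒previousWins : (p : Position n) → Acc _<_ (sum p) → AllEven p → IsPPosition p
allEven⇒previousWins p (acc rs) even = reply λ where
  q (S , (i , i∈S) , legal , refl) →
    let legal′ = removeOne-repeatable S p even legal
        r      = removeOne S q
        r<p    = <-trans (sum-removeOne-< q i∈S (legal′ i i∈S))
                         (sum-removeOne-< p i∈S (legal i i∈S))
    in move r (S , (i , i∈S) , legal′ , refl)
         (allEven⇒previousWins r (rs r<p) (removeOne-twice-even S p even))

oddPiles : Position n → Subset n
oddPiles = map λ m → not (does (2 ∣? m))

lookup-oddPiles : ∀ (p : Position n) i → lookup (oddPiles p) i ≡ not (does (2 ∣? lookup p i))
lookup-oddPiles p i = lookup-map i _ p

∈-oddPiles⁻ : ∀ (p : Position n) i → i ∈ oddPiles p → 2 ∤ lookup p i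
∈-oddPiles⁻ p i i∈ even
  -- The chain of equalities reads `false ≡ true`: evenness makes the entry of `oddPiles p` at `i`
  -- false, membership makes it true.
  with () ← trans (sym (cong not (dec-true (2 ∣? lookup p i) even)))
                  (trans (sym (lookup-oddPiles p i)) ([]=⇒lookup i∈))

∈-oddPiles⁺ : ∀ (p : Position n) i → 2 ∤ lookup p i → i ∈ oddPiles p
∈-oddPiles⁺ p i odd = lookup⇒[]= i _
  (trans (lookup-oddPiles p i) (cong not (dec-false (2 ∣? lookup p i) odd)))

-- Taking an arbitrary decision `even?` as an argument lets a match on it reduce both `does` and the
-- conditional.
2∣pred-unless-even : ∀ m (even? : Dec (2 ∣ m)) → 2 ∣ (if not (does even?) then pred m else m)
2∣pred-unless-even m (yes even) = even
2∣pred-unless-even m (no odd)   = 2∤n⇒2∣pred[n] m odd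

removeOne-oddPiles-even : (p : Position n) → AllEven (removeOne (oddPiles p) p)
removeOne-oddPiles-even p i
  rewrite lookup-removeOne (oddPiles p) p i | lookup-oddPiles p i =
  2∣pred-unless-even (lookup p i) (2 ∣? lookup p i)

-- Divisibility by 2 is decidable, so it suffices to refute an odd pile `i`. Such a pile makes the
-- move on all odd piles nonempty, hence legal; the all-even option `q` would then be won by both
-- players.
previousWins⇒allEven : (p : Position n) → IsPPosition p → AllEven p
previousWins⇒allEven p (reply f) i with 2 ∣? lookup p i
... | yes even = even
... | no  odd  = contradiction (f q p⟶q) (previousWins-nextWins-⊥ q-wins)
  where
  q      = removeOne (oddPiles p) p
  q-wins = allEven⇒previousWins q (<-wellFounded _) (removeOne-oddPiles-even p)
  p⟶q    = oddPiles p , (i , ∈-oddPiles⁺ p i odd)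
         , (λ j j∈ → 2∤n⇒n>0 (lookup p j) (∈-oddPiles⁻ p j j∈)) , refl

proposition1p2 : ∀ (n : ℕ) (p : Position n) → IsPPosition p ⇔ (∀ i → 2 ∣ lookup p i)
proposition1p2 n p = mk⇔ (previousWins⇒allEven p) (allEven⇒previousWins p (<-wellFounded _))
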